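{- Let $A$ be a meet-semilattice and $\kappa$ a regular cardinal. The following are equivalent: (1) every $\kappa$-join in $\mathcal{DM} A$ is distributive; (2) $\mathcal{DM} A$ is a $\kappa$-frame; (3) $\mathcal{BL}_\kappa(\mathcal{DM} A)=\mathcal{DM} A$.
   Context: A meet-semilattice is a poset with all finite meets. $\mathcal{DM} A$ is the complete lattice of normal ideals of $A$ (downsets $N$ with $N=N^{u\ell}$, where ${}^u,{}^\ell$ denote upper and lower bounds). An existing join $\bigvee S$ is distributive if $a\wedge\bigvee S=\bigvee\{a\wedge s:s\in S\}$ for all $a$. A D-ideal is a downset containing $\bigvee S$ for each subset $S$ of it with distributive join; $\mathcal{BL} A$ is the frame of D-ideals, and every normal ideal is a D-ideal, so $\mathcal{DM} A\subseteq\mathcal{BL} A$ (with $\mathcal{BL}(\mathcal{DM} A)$ identified with $\mathcal{BL} A$). A $\kappa$-join is a join of fewer than $\kappa$ elements; a $\kappa$-frame is a meet-semilattice in which all $\kappa$-joins exist and are distributive. $\mathcal{BL}_\kappa(\mathcal{DM} A)$ denotes the sub-$\kappa$-frame of $\mathcal{BL} A$ generated by $\mathcal{DM} A$ (closure of $\mathcal{DM} A$ under finite meets and $\kappa$-joins computed in $\mathcal{BL} A$). -}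

module Defs where

open import Data.Nat.Base using (ℕ)
open import Data.Product.Base using (_×_; _,_; proj₁; proj₂; ∃)
open import Data.Refinement.Base using (Refinement-syntax)
open import Data.Unit.Polymorphic.Base using (⊤; tt)
open import Function.Bundles using (_↣_)
open import Induction.WellFounded using (WellFounded)
open import Level using (Level; suc; _⊔_)
open import Relation.Binary.Core using (Rel)
open import Relation.Binary.Lattice.Bundles using (BoundedMeetSemilattice)
open import Relation.Binary.PropositionalEquality.Core using (_≡_)
open import Relation.Binary.Structures using (IsStrictTotalOrder)
open import Relation.Nullary.Negation.Core using (¬_)
open import Relation.Unary using (Pred; _∈_; _⊆_; _≐_; _∩_)
open import Relation.Unary.Properties using (≐-refl; ≐-sym; ≐-trans)

private
  variable
    c ℓ ℓ₁ ℓ₂ p : Level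

-- A universe level ℓ plays the role of "all sets": semilattices, cardinals and
-- subsets live at ℓ, while the collections of ideals live at suc ℓ.

-- An infinite regular cardinal, as an initial ordinal (a well-order which does
-- not inject into any of its proper initial segments) in which no map from a
-- proper initial segment is cofinal.
record RegularCardinal (ℓ : Level) : Set (suc ℓ) where
  infix 4 _<_
  field
    Carrier            : Set ℓ
    _<_                : Rel Carrier ℓ
    isStrictTotalOrder : IsStrictTotalOrder _≡_ _<_
    wellFounded        : WellFounded _<_

  -- The refinement type keeps the proof of y < x irrelevant, so that Below x
  -- has exactly one element for each y < x.
  Below : Carrier → Set ℓ
  Below x = [ y ∈ Carrier ∣ y < x ]

  field
    initial  : ∀ x → ¬ (Carrier ↣ Below x)
    infinite : ℕ ↣ Carrier
    regular  : ∀ x (f : Below x → Carrier) → ∃ λ y → ∀ i → f i < y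

module _ (L : BoundedMeetSemilattice c ℓ₁ ℓ₂) where
  open BoundedMeetSemilattice L using (Carrier; _≈_; _≤_; _∧_)

  UpperBounds : Pred Carrier p → Pred Carrier (c ⊔ ℓ₂ ⊔ p)
  UpperBounds S u = ∀ {s} → s ∈ S → s ≤ u

  LowerBounds : Pred Carrier p → Pred Carrier (c ⊔ ℓ₂ ⊔ p)
  LowerBounds S l = ∀ {s} → s ∈ S → l ≤ s

  IsDownset : Pred Carrier p → Set (c ⊔ ℓ₂ ⊔ p)
  IsDownset S = ∀ {x y} → x ≤ y → y ∈ S → x ∈ S

  IsJoin : Pred Carrier p → Carrier → Set (c ⊔ ℓ₂ ⊔ p)
  IsJoin S j = j ∈ UpperBounds S × j ∈ LowerBounds (UpperBounds S)

  -- { a ∧ s : s ∈ S }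
  MeetWith : Carrier → Pred Carrier p → Pred Carrier (c ⊔ ℓ₁ ⊔ p)
  MeetWith a S y = ∃ λ s → s ∈ S × y ≈ a ∧ s

  IsDistributiveJoin : Pred Carrier p → Carrier → Set (c ⊔ ℓ₁ ⊔ ℓ₂ ⊔ p)
  IsDistributiveJoin S j = IsJoin S j × (∀ a → IsJoin (MeetWith a S) (a ∧ j))

-- Here L has level ℓ for its two relations, while its carrier may be large, so
-- as to apply to the lattices of ideals of a semilattice at level ℓ.
module _ (κ : RegularCardinal ℓ) (L : BoundedMeetSemilattice c ℓ ℓ) where
  open BoundedMeetSemilattice L using (Carrier; _≈_; _∧_) renaming (⊤ to 1L)

  -- S has fewer than κ elements: it is enumerated, up to the equality of L, by
  -- a proper initial segment of κ. Repetitions are harmless, because the image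
  -- of a proper initial segment again has cardinality below κ.
  FewerThan : Pred Carrier ℓ → Set (c ⊔ ℓ)
  FewerThan S = ∃ λ x → ∃ λ (f : RegularCardinal.Below κ x → Carrier) →
    S ≐ (λ y → ∃ λ i → y ≈ f i)

  AllκJoinsExist : Set (c ⊔ suc ℓ)
  AllκJoinsExist = ∀ S → FewerThan S → ∃ λ j → IsJoin L S j

  EveryκJoinDistributive : Set (c ⊔ suc ℓ)
  EveryκJoinDistributive =
    ∀ S → FewerThan S → ∀ j → IsJoin L S j → IsDistributiveJoin L S j

  record IsκFrame : Set (c ⊔ suc ℓ) where
    field
      joinsExist        : AllκJoinsExist
      joinsDistributive : EveryκJoinDistributive

  -- The closure of G under finite meets and κ-joins computed in L.
  data Generated (G : Pred Carrier p) : Pred Carrier (c ⊔ suc ℓ ⊔ p) where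
    generator : ∀ {x} → x ∈ G → Generated G x
    respects  : ∀ {x y} → x ≈ y → Generated G x → Generated G y
    top       : Generated G 1L
    meet      : ∀ {x y} → Generated G x → Generated G y → Generated G (x ∧ y)
    join      : ∀ S {j} → FewerThan S → S ⊆ Generated G → IsJoin L S j →
                Generated G j

module _ (A : BoundedMeetSemilattice ℓ ℓ ℓ) where
  open BoundedMeetSemilattice A using (Carrier)

  record NormalIdeal : Set (suc ℓ) where
    field
      set       : Pred Carrier ℓ
      isDownset : IsDownset A set
      isNormal  : set ≐ LowerBounds A (UpperBounds A set)

  record DIdeal : Set (suc ℓ) where
    field
      set       : Pred Carrier ℓ
      isDownset : IsDownset A set
      isClosed  : ∀ (S : Pred Carrier ℓ) → S ⊆ set →
                  ∀ {j} → IsDistributiveJoin A S j → j ∈ set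

  private
    _∩ᴺ_ : NormalIdeal → NormalIdeal → NormalIdeal
    M ∩ᴺ N = record
      { set       = M.set ∩ N.set
      ; isDownset = λ x≤y (yM , yN) → M.isDownset x≤y yM , N.isDownset x≤y yN
      ; isNormal  = (λ x∈ u → u x∈)
                  , (λ x∈ → proj₂ M.isNormal (λ u → x∈ (λ (sM , _) → u sM))
                          , proj₂ N.isNormal (λ u → x∈ (λ (_ , sN) → u sN)))
      }
      where module M = NormalIdeal M
            module N = NormalIdeal N

    _∩ᴰ_ : DIdeal → DIdeal → DIdeal
    I ∩ᴰ J = record
      { set       = I.set ∩ J.set
      ; isDownset = λ x≤y (yI , yJ) → I.isDownset x≤y yI , J.isDownset x≤y yJ
      ; isClosed  = λ S S⊆ d → I.isClosed S (λ s → proj₁ (S⊆ s)) d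
                             , J.isClosed S (λ s → proj₂ (S⊆ s)) d
      }
      where module I = DIdeal I
            module J = DIdeal J

  𝒟ℳ : BoundedMeetSemilattice (suc ℓ) ℓ ℓ
  𝒟ℳ = record
    { Carrier = NormalIdeal
    ; _≈_     = λ M N → set M ≐ set N
    ; _≤_     = λ M N → set M ⊆ set N
    ; _∧_     = _∩ᴺ_
    ; ⊤       = record
      { set       = λ _ → ⊤
      ; isDownset = λ _ _ → tt
      ; isNormal  = (λ x∈ u → u x∈) , (λ _ → tt)
      }
    ; isBoundedMeetSemilattice = record
      { isMeetSemilattice = record
        { isPartialOrder = record
          { isPreorder = record
            { isEquivalence = record
              { refl = ≐-refl ; sym = ≐-sym ; trans = ≐-trans }
            ; reflexive = proj₁
            ; trans     = λ p q x → q (p x)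
            }
          ; antisym = _,_
          }
        ; infimum = λ _ _ → proj₁ , proj₂ , λ _ p q x → p x , q x
        }
      ; maximum = λ _ _ → tt
      }
    }
    where open NormalIdeal

  ℬℒ : BoundedMeetSemilattice (suc ℓ) ℓ ℓ
  ℬℒ = record
    { Carrier = DIdeal
    ; _≈_     = λ I J → set I ≐ set J
    ; _≤_     = λ I J → set I ⊆ set J
    ; _∧_     = _∩ᴰ_
    ; ⊤       = record
      { set       = λ _ → ⊤
      ; isDownset = λ _ _ → tt
      ; isClosed  = λ _ _ _ → tt
      }
    ; isBoundedMeetSemilattice = record
      { isMeetSemilattice = record
        { isPartialOrder = record
          { isPreorder = record
            { isEquivalence = record
              { refl = ≐-refl ; sym = ≐-sym ; trans = ≐-trans }
            ; reflexive = proj₁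
            ; trans     = λ p q x → q (p x)
            }
          ; antisym = _,_
          }
        ; infimum = λ _ _ → proj₁ , proj₂ , λ _ p q x → p x , q x
        }
      ; maximum = λ _ _ → tt
      }
    }
    where open DIdeal

  𝒟ℳ↪ℬℒ : NormalIdeal → DIdeal
  𝒟ℳ↪ℬℒ N = record
    { set       = set
    ; isDownset = isDownset
    ; isClosed  = λ S S⊆N ((_ , least) , _) →
        proj₂ isNormal (λ u → least (λ s → u (S⊆N s)))
    }
    where open NormalIdeal N

  -- 𝒟ℳ A as a subset of ℬℒ A.
  𝒟ℳ⊆ℬℒ : Pred DIdeal (suc ℓ)
  𝒟ℳ⊆ℬℒ J = ∃ λ N → BoundedMeetSemilattice._≈_ ℬℒ J (𝒟ℳ↪ℬℒ N)

  ℬℒκ𝒟ℳ : RegularCardinal ℓ → Pred DIdeal (suc ℓ)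
  ℬℒκ𝒟ℳ κ = Generated κ ℬℒ 𝒟ℳ⊆ℬℒ

-- Everything rests on the explicit form of the D-ideal ⟨D⟩ generated by a
-- downset D: it consists of the a such that every b ≤ a is the join of ↓b ∩ D.
-- For a family of normal ideals with union D, ⟨D⟩ is the join in ℬℒ A, and it
-- is contained in the normal closure of D, which is the join in 𝒟ℳ A. That join
-- is distributive precisely when it is contained in ⟨D⟩, that is, when the two
-- joins agree.
module Submission where

open import Defs
open import Data.Product.Base using (_×_; _,_; proj₁; proj₂; ∃)
open import Function.Base using (_∘_)
open import Function.Bundles using (_⇔_; mk⇔)
open import Level using (Level)
open import Relation.Binary.Lattice.Bundles using (BoundedMeetSemilattice)
open import Relation.Unary using (Pred; _∈_; _⊆_; _≐_; _∩_; ⋃)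
open import Relation.Unary.Properties using (≐-refl; ≐-sym; ≐-trans)

private
  variable
    c ℓ ℓ₁ ℓ₂ p : Level

module _ (L : BoundedMeetSemilattice c ℓ₁ ℓ₂) where
  open BoundedMeetSemilattice L

  Image : {I : Set p} → (I → Carrier) → Pred Carrier _
  Image f y = ∃ λ i → y ≈ f i

  -- Monotonicity of meets already makes `a ∧ j` an upper bound, so only leastness has to be
  -- supplied.
  isJoin⇒distributive : {S : Pred Carrier p} {j : Carrier} → IsJoin L S j →
    (∀ a → a ∧ j ∈ LowerBounds L (UpperBounds L (MeetWith L a S))) →
    IsDistributiveJoin L S j
  isJoin⇒distributive isJoin least = isJoin , λ a →
    (λ (s , s∈S , y≈a∧s) → trans (reflexive y≈a∧s)
      (∧-greatest (x∧y≤x a s) (trans (x∧y≤y a s) (proj₁ isJoin s∈S))))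
    , least a

module Ideals (A : BoundedMeetSemilattice ℓ ℓ ℓ) where
  open BoundedMeetSemilattice A
  open NormalIdeal using (set; isDownset; isNormal)

  private
    module DM = BoundedMeetSemilattice (𝒟ℳ A)
    module BL = BoundedMeetSemilattice (ℬℒ A)

  ↓ : Carrier → Pred Carrier ℓ
  ↓ a x = x ≤ a

  lowerUpper : Pred Carrier ℓ → Pred Carrier ℓ
  lowerUpper D = LowerBounds A (UpperBounds A D)

  lowerUpper-mono : {D E : Pred Carrier ℓ} → D ⊆ E → lowerUpper D ⊆ lowerUpper E
  lowerUpper-mono D⊆E x∈ u = x∈ (u ∘ D⊆E)

  normalClosure : Pred Carrier ℓ → NormalIdeal A
  normalClosure D = record
    { set       = lowerUpper D
    ; isDownset = λ x≤y y∈ u → trans x≤y (y∈ u)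
    ; isNormal  = (λ x∈ u → u x∈) , (λ x∈ u → x∈ (λ s∈ → s∈ u))
    }

  ⊆-normalClosure : (D : Pred Carrier ℓ) → D ⊆ set (normalClosure D)
  ⊆-normalClosure _ x∈D u = u x∈D

  normalClosure-least : {D : Pred Carrier ℓ} (N : NormalIdeal A) →
    D ⊆ set N → set (normalClosure D) ⊆ set N
  normalClosure-least N D⊆N = proj₂ (isNormal N) ∘ lowerUpper-mono D⊆N

  -- Asking this of every `b ≤ a`, not of `a` alone, builds in stability under meets; this is what
  -- makes the join of `↓ a ∩ D` distributive.
  dClosure : Pred Carrier ℓ → Pred Carrier ℓ
  dClosure D a = ∀ {b} → b ≤ a → b ∈ lowerUpper (↓ b ∩ D)

  dClosureIdeal : Pred Carrier ℓ → DIdeal A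
  dClosureIdeal D = record
    { set       = dClosure D
    ; isDownset = λ x≤y y∈ b≤x → y∈ (trans b≤x x≤y)
    -- As `b` is the join of the `b ∧ s`, it suffices to bound each of these. Since `b ∧ s` lies
    -- below `s ∈ dClosure D`, it is the join of elements of `D`, all of them below `b`.
    ; isClosed  = λ S S⊆ {j} (_ , distrib) {b} b≤j u →
        trans (∧-greatest refl b≤j)
          (proj₂ (distrib b) λ (s , s∈S , y≈b∧s) →
            trans (reflexive y≈b∧s)
              (S⊆ s∈S (x∧y≤y b s) λ (t≤b∧s , t∈D) →
                u (trans t≤b∧s (x∧y≤x b s) , t∈D)))
    }

  dClosure-isDistributiveJoin : {D : Pred Carrier ℓ} {a : Carrier} →
    a ∈ dClosure D → IsDistributiveJoin A (↓ a ∩ D) a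
  dClosure-isDistributiveJoin {a = a} a∈ =
    isJoin⇒distributive A (proj₁ , a∈ refl) λ c u →
      -- The element `c ∧ a` is the join of the `t ∈ D` below it, and each such `t` satisfies
      -- `t ≤ c ∧ t`.
      a∈ (x∧y≤y c a) λ {t} (t≤c∧a , t∈D) →
        trans (∧-greatest (trans t≤c∧a (x∧y≤x c a)) refl)
          (u (t , (trans t≤c∧a (x∧y≤y c a) , t∈D) , Eq.refl))

  dClosure-least : {D : Pred Carrier ℓ} (J : DIdeal A) →
    D ⊆ DIdeal.set J → dClosure D ⊆ DIdeal.set J
  dClosure-least J D⊆J a∈ =
    DIdeal.isClosed J _ (D⊆J ∘ proj₂) (dClosure-isDistributiveJoin a∈)

  module _ {I : Set ℓ} (N : I → NormalIdeal A) where

    private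
      union : Pred Carrier ℓ
      union = ⋃ I (set ∘ N)

    normalClosure-isJoin : {S : Pred (NormalIdeal A) ℓ} → S ≐ Image (𝒟ℳ A) N →
      IsJoin (𝒟ℳ A) S (normalClosure union)
    normalClosure-isJoin (S⊆ , ⊆S) =
      (λ s∈S x∈s → let i , s≐Ni = S⊆ s∈S in
        ⊆-normalClosure union (i , proj₁ s≐Ni x∈s))
      , λ {M} u → normalClosure-least M λ (i , x∈Ni) →
          u {N i} (⊆S (i , ≐-refl)) x∈Ni

    dClosure-isJoin :
      IsJoin (ℬℒ A) (Image (ℬℒ A) (𝒟ℳ↪ℬℒ A ∘ N)) (dClosureIdeal union)
    dClosure-isJoin =
      (λ (i , s≐Ni) x∈s b≤x u →
        u (refl , i , isDownset (N i) b≤x (proj₁ s≐Ni x∈s)))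
      , λ {J} u → dClosure-least J λ (i , x∈Ni) →
          u {𝒟ℳ↪ℬℒ A (N i)} (i , ≐-refl) x∈Ni

    -- Distributivity is tested on the principal ideal of `b`, which `normalClosure (↓ b)` is: its
    -- meets with members of `S` all lie in the normal closure of `↓ b ∩ union`, hence so does its
    -- meet with `j`, which contains `b`.
    distributive⇒⊆dClosure : {S : Pred (NormalIdeal A) ℓ} {j : NormalIdeal A} →
      S ⊆ Image (𝒟ℳ A) N → IsDistributiveJoin (𝒟ℳ A) S j → set j ⊆ dClosure union
    distributive⇒⊆dClosure {j = j} S⊆ (_ , distrib) a∈j {b} b≤a =
      proj₂ (distrib (normalClosure (↓ b))) {normalClosure (↓ b ∩ union)}
        (λ (s , s∈S , y≐) x∈y →
          let i , s≐Ni = S⊆ s∈S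
              x∈↓b , x∈s = proj₁ y≐ x∈y
          in ⊆-normalClosure (↓ b ∩ union) (x∈↓b (λ t≤b → t≤b) , i , proj₁ s≐Ni x∈s))
        (⊆-normalClosure (↓ b) refl , isDownset j b≤a a∈j)

    -- A point `x` of `M` and `j` is the join of the points of the union below it. These lie in some
    -- `M DM.∧ N i`, hence in `P`, and normality of `P` yields `x`.
    ⊆dClosure⇒distributive : {S : Pred (NormalIdeal A) ℓ} {j : NormalIdeal A} →
      Image (𝒟ℳ A) N ⊆ S → IsJoin (𝒟ℳ A) S j → set j ⊆ dClosure union →
      IsDistributiveJoin (𝒟ℳ A) S j
    ⊆dClosure⇒distributive {j = j} ⊆S isJoin j⊆ =
      isJoin⇒distributive (𝒟ℳ A) {j = j} isJoin λ M {P} u (x∈M , x∈j) →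
        normalClosure-least P
          (λ (t≤x , i , t∈Ni) →
            u {M DM.∧ N i} (N i , ⊆S (i , ≐-refl) , ≐-refl)
              (isDownset M t≤x x∈M , t∈Ni))
          (j⊆ x∈j refl)

  module _ (κ : RegularCardinal ℓ) where

    𝒟ℳ-joinsExist : AllκJoinsExist κ (𝒟ℳ A)
    𝒟ℳ-joinsExist S (_ , N , S≐) =
      normalClosure (⋃ _ (set ∘ N)) , normalClosure-isJoin N S≐

    distributive⇒generated⊆𝒟ℳ :
      EveryκJoinDistributive κ (𝒟ℳ A) → ℬℒκ𝒟ℳ A κ ⊆ 𝒟ℳ⊆ℬℒ A
    distributive⇒generated⊆𝒟ℳ distrib = normal
      where
      normal : ℬℒκ𝒟ℳ A κ ⊆ 𝒟ℳ⊆ℬℒ A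
      normal (generator x∈) = x∈
      normal (respects x≐y gx) = let M , x≐M = normal gx in
        M , ≐-trans (≐-sym x≐y) x≐M
      normal top = DM.⊤ , ≐-refl
      normal (meet gx gy) =
        let M , x⊆M , M⊆x = normal gx
            N , y⊆N , N⊆y = normal gy
        in M DM.∧ N , (λ (p , q) → x⊆M p , y⊆N q) , (λ (p , q) → M⊆x p , N⊆y q)
      normal (join S {j} (x , f , S⊆ , ⊆S) S⊆gen (upper , least)) =
        -- The join `j` in `ℬℒ A` is squeezed: it lies in `J`, which lies in `dClosure union`, which
        -- lies in `j`.
        J , least {𝒟ℳ↪ℬℒ A J} S≤J , dClosure-least j union⊆j ∘ J⊆dClosure
        where
        f∈S : ∀ i → f i ∈ S
        f∈S i = ⊆S (i , ≐-refl)

        f-normal : ∀ i → f i ∈ 𝒟ℳ⊆ℬℒ A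
        f-normal i = normal (S⊆gen (f∈S i))

        N : RegularCardinal.Below κ x → NormalIdeal A
        N = proj₁ ∘ f-normal

        f≐N : ∀ i → f i BL.≈ 𝒟ℳ↪ℬℒ A (N i)
        f≐N = proj₂ ∘ f-normal

        union : Pred Carrier ℓ
        union = ⋃ _ (set ∘ N)

        J : NormalIdeal A
        J = normalClosure union

        S≤J : 𝒟ℳ↪ℬℒ A J ∈ UpperBounds (ℬℒ A) S
        S≤J s∈S x∈s = let i , s≐fi = S⊆ s∈S in
          ⊆-normalClosure union (i , proj₁ (f≐N i) (proj₁ s≐fi x∈s))

        union⊆j : union ⊆ DIdeal.set j
        union⊆j (i , x∈Ni) = upper (f∈S i) (proj₂ (f≐N i) x∈Ni)

        J⊆dClosure : set J ⊆ dClosure union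
        -- The members of `S` are D-ideals that are only equal to normal ones, so the hypothesis is
        -- applied to the image of `N` in `𝒟ℳ A`.
        J⊆dClosure = distributive⇒⊆dClosure N {j = J} (λ s∈ → s∈)
          (distrib (Image (𝒟ℳ A) N) (x , N , ≐-refl) J (normalClosure-isJoin N ≐-refl))

    -- The join in `ℬℒ A` of the family is generated, hence equal to a normal ideal `M`. This `M`
    -- bounds `S`, so it contains `j`, which is the criterion for distributivity.
    generated⊆𝒟ℳ⇒distributive :
      ℬℒκ𝒟ℳ A κ ⊆ 𝒟ℳ⊆ℬℒ A → EveryκJoinDistributive κ (𝒟ℳ A)
    generated⊆𝒟ℳ⇒distributive gen⊆ S (x , N , S⊆ , ⊆S) j isJoin =
      let M , K⊆M , M⊆K = gen⊆ {dClosureIdeal (⋃ _ (set ∘ N))}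
            (join (Image (ℬℒ A) (𝒟ℳ↪ℬℒ A ∘ N)) (x , 𝒟ℳ↪ℬℒ A ∘ N , ≐-refl)
              (λ (i , s≐Ni) → generator (N i , s≐Ni)) (dClosure-isJoin N))
          S≤M : M ∈ UpperBounds (𝒟ℳ A) S
          S≤M s∈S y∈s = let i , s≐Ni = S⊆ s∈S in
            K⊆M (proj₁ (dClosure-isJoin N) {𝒟ℳ↪ℬℒ A (N i)} (i , ≐-refl)
              (proj₁ s≐Ni y∈s))
      in ⊆dClosure⇒distributive N {j = j} ⊆S isJoin (M⊆K ∘ proj₂ isJoin {M} S≤M)

theorem4p4 : ∀ {ℓ} (A : BoundedMeetSemilattice ℓ ℓ ℓ) (κ : RegularCardinal ℓ) →
    (EveryκJoinDistributive κ (𝒟ℳ A) ⇔ IsκFrame κ (𝒟ℳ A)) ×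
    (IsκFrame κ (𝒟ℳ A) ⇔ ℬℒκ𝒟ℳ A κ ≐ 𝒟ℳ⊆ℬℒ A)
theorem4p4 A κ = mk⇔ isκFrame joinsDistributive ,
  mk⇔ isκFrame⇒generated≐𝒟ℳ generated≐𝒟ℳ⇒isκFrame
  where
  open Ideals A
  open IsκFrame using (joinsDistributive)

  -- Normal closures of unions provide the joins, so distributivity is all that remains of being a
  -- κ-frame.
  isκFrame : EveryκJoinDistributive κ (𝒟ℳ A) → IsκFrame κ (𝒟ℳ A)
  isκFrame distrib = record
    { joinsExist        = 𝒟ℳ-joinsExist κ
    ; joinsDistributive = distrib
    }

  isκFrame⇒generated≐𝒟ℳ : IsκFrame κ (𝒟ℳ A) → ℬℒκ𝒟ℳ A κ ≐ 𝒟ℳ⊆ℬℒ A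
  isκFrame⇒generated≐𝒟ℳ frame =
    distributive⇒generated⊆𝒟ℳ κ (joinsDistributive frame) , generator

  generated≐𝒟ℳ⇒isκFrame : ℬℒκ𝒟ℳ A κ ≐ 𝒟ℳ⊆ℬℒ A → IsκFrame κ (𝒟ℳ A)
  generated≐𝒟ℳ⇒isκFrame (gen⊆ , _) = isκFrame (generated⊆𝒟ℳ⇒distributive κ gen⊆)
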